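{- For any range map $\delta$, the space $\mathcal{V}_\delta$ is an operad ideal of the operad $\mathbf{Cl}_{\bar{\delta}}$ if and only if $\delta$ is unimodal.
   Context: $\mathbb{N}=\{0,1,2,\dots\}$ and $\mathbb{K}$ is a field of characteristic zero. Operads are nonsymmetric operads in $\mathbb{K}$-vector spaces, with partial compositions $\circ_i$ and a unit; an operad ideal of an operad $\mathcal{O}$ is a graded subspace $\mathcal{V}$ such that $f\circ_i g\in\mathcal{V}$ whenever $f,g$ are homogeneous and $f\in\mathcal{V}$ or $g\in\mathcal{V}$. A range map is a map $\delta:\mathbb{N}\setminus\{0\}\to\mathbb{N}$. It is unimodal if there are no $1\le i_1<i_2<i_3$ with $\delta(i_1)>\delta(i_2)<\delta(i_3)$. For a range map $\delta$, let $\bar{\delta}$ be the (weakly increasing) range map $\bar{\delta}(i):=\max\{\delta(1),\dots,\delta(i)\}$. For a word $w$ on $\mathbb{N}$, $\ell(w)$ is its length, $w(i)$ its $i$-th letter, and $\epsilon$ is the empty word. A $\delta$-cliff is a word $w$ on $\mathbb{N}$ such that $0\le w(i)\le\delta(i)$ for all $1\le i\le\ell(w)$. Its size is $|w|:=\ell(w)+1$. $\mathsf{Cl}_\delta$ is the graded set (by size) of all $\delta$-cliffs; note $\mathsf{Cl}_\delta\subseteq\mathsf{Cl}_{\bar\delta}$. For words $u,v$ and $1\le i\le |u|$, set $u\,\square_i\,v:=u(1)\cdots u(i-1)\;v\;u(i)\cdots u(\ell(u))$ (insertion of $v$ into $u$ just before its $i$-th letter, or at the end if $i=|u|$). For a weakly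 increasing range map $\rho$, $\mathbf{Cl}_\rho$ is the operad with basis $\{\mathsf{E}_w:w\in\mathsf{Cl}_\rho\}$, where $\mathsf{E}_w$ has arity $|w|$, partial compositions given by $\mathsf{E}_u\circ_i\mathsf{E}_v:=\mathsf{E}_{u\,\square_i\,v}$, and unit $\mathsf{E}_\epsilon$. $\mathcal{V}_\delta$ is the graded subspace of $\mathbf{Cl}_{\bar\delta}$ spanned by $\{\mathsf{E}_w: w\in\mathsf{Cl}_{\bar\delta}\setminus\mathsf{Cl}_\delta\}$. -}

module Defs where

open import Algebra.Apartness.Bundles using (HeytingField; HeytingCommutativeRing)
open import Algebra.Bundles using (CommutativeRing; CommutativeMonoid)
open import Algebra.Module.Bundles using (Module)
open import Algebra.Module.Structures.Biased using (IsModuleFromLeft)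
import Algebra.Definitions.RawMonoid as RawMonoid
import Algebra.Module.Morphism.Structures as ModuleMorphisms
import Algebra.Module.Properties as ModuleProperties
import Algebra.Properties.CommutativeSemigroup as CommutativeSemigroupProperties
open import Data.Fin.Base using (Fin; zero; suc; toℕ)
open import Data.Fin.Properties using (toℕ<n)
open import Data.Irrelevant using ([_])
open import Data.List.Base using (List; []; _∷_; _++_; length; lookup; take; drop; map; upTo)
open import Data.List.Extrema.Nat using (max; max-mono-⊆)
open import Data.List.Membership.Propositional.Properties using (∈-upTo⁺; ∈-upTo⁻)
open import Data.List.Properties using (++-assoc; ++-identityʳ; take++drop≡id)
open import Data.List.Relation.Binary.Subset.Propositional.Properties using (map⁺)
open import Data.Nat.Base using (ℕ; zero; suc; _+_; _≤_; _<_; _>_; NonZero; z≤n; s≤s; s≤s⁻¹)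
open import Data.Nat.Properties
  using (_≟_; ≤-trans; n≤1+n; <-≤-trans; ≤-reflexive; +-suc; +-comm; suc-injective; +-identityʳ)
open import Data.Product.Base using (Σ-syntax; _×_; _,_; proj₁; proj₂)
open import Data.Refinement using (Refinement-syntax; _,_; value; value-injective)
open import Data.Sum.Base using (_⊎_)
open import Level using (Level; 0ℓ; _⊔_) renaming (suc to lsuc)
open import Relation.Binary.PropositionalEquality
  using (_≡_; refl; sym; trans; cong; subst)
open import Relation.Nullary using (¬_; recompute)
open import Relation.Unary using (Pred; _∈_)

private
  variable
    c r ℓ ℓ₁ ℓ₂ b m m′ ℓm ℓm′ p : Level

-- Classically, a Heyting field is a field with _≉_ as its apartness;
-- irreflexivity of _#_ excludes the zero ring.
scalars : HeytingField c ℓ₁ ℓ₂ → CommutativeRing c ℓ₁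
scalars K = HeytingCommutativeRing.commutativeRing (HeytingField.heytingCommutativeRing K)

CharacteristicZero : HeytingField c ℓ₁ ℓ₂ → Set ℓ₁
CharacteristicZero K = ∀ n → n · 1# ≈ 0# → n ≡ 0
  where
  open CommutativeRing (scalars K)
  open RawMonoid +-rawMonoid renaming (_×_ to _·_)

VectorSpace : HeytingField c ℓ₁ ℓ₂ → (m ℓm : Level) → Set (c ⊔ ℓ₁ ⊔ lsuc (m ⊔ ℓm))
VectorSpace K = Module (scalars K)

module _ {R : CommutativeRing r ℓ} where

  IsLinear : (M : Module R m ℓm) (N : Module R m′ ℓm′) →
             (Module.Carrierᴹ M → Module.Carrierᴹ N) → Set (r ⊔ m ⊔ ℓm ⊔ ℓm′)
  IsLinear M N = IsModuleHomomorphism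
    where open ModuleMorphisms.ModuleMorphisms (Module.rawModule M) (Module.rawModule N)

  record IsSubspace (M : Module R m ℓm) (V : Pred (Module.Carrierᴹ M) p) : Set (r ⊔ m ⊔ ℓm ⊔ p) where
    open CommutativeRing R using (Carrier)
    open Module M
    field
      resp      : ∀ {x y} → x ≈ᴹ y → x ∈ V → y ∈ V
      0ᴹ-closed : 0ᴹ ∈ V
      +ᴹ-closed : ∀ {x y} → x ∈ V → y ∈ V → (x +ᴹ y) ∈ V
      *ₗ-closed : ∀ (a : Carrier) {x} → x ∈ V → (a *ₗ x) ∈ V

  data Span (M : Module R m ℓm) (S : Pred (Module.Carrierᴹ M) p) :
            Pred (Module.Carrierᴹ M) (r ⊔ m ⊔ ℓm ⊔ p) where
    incl  : ∀ {x} → x ∈ S → x ∈ Span M S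
    resp  : ∀ {x y} → Module._≈ᴹ_ M x y → x ∈ Span M S → y ∈ Span M S
    zero  : Module.0ᴹ M ∈ Span M S
    plus  : ∀ {x y} → x ∈ Span M S → y ∈ Span M S → Module._+ᴹ_ M x y ∈ Span M S
    scale : ∀ (a : CommutativeRing.Carrier R) {x} → x ∈ Span M S → Module._*ₗ_ M a x ∈ Span M S

-- The free module with basis B is the term algebra on B modulo the
-- congruence generated by the module axioms, so `basis` is universal.
module FreeModule (R : CommutativeRing r ℓ) (B : Set b) where

  open CommutativeRing R using (Carrier; _≈_; _*_; -_; 0#; 1#)
  private module R = CommutativeRing R

  infixl 6 _⊕_
  infixr 7 _⊙_
  infix  4 _≋_

  data Combination : Set (r ⊔ b) where
    basis : B → Combination
    𝟘     : Combination
    _⊕_   : Combination → Combination → Combination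
    _⊙_   : Carrier → Combination → Combination

  data _≋_ : Combination → Combination → Set (r ⊔ ℓ ⊔ b) where
    ≋-refl      : ∀ {x} → x ≋ x
    ≋-sym       : ∀ {x y} → x ≋ y → y ≋ x
    ≋-trans     : ∀ {x y z} → x ≋ y → y ≋ z → x ≋ z
    ⊕-cong      : ∀ {x x′ y y′} → x ≋ x′ → y ≋ y′ → x ⊕ y ≋ x′ ⊕ y′
    ⊙-cong      : ∀ {a a′ x x′} → a ≈ a′ → x ≋ x′ → a ⊙ x ≋ a′ ⊙ x′
    ⊕-assoc     : ∀ x y z → (x ⊕ y) ⊕ z ≋ x ⊕ (y ⊕ z)
    ⊕-comm      : ∀ x y → x ⊕ y ≋ y ⊕ x
    ⊕-identityˡ : ∀ x → 𝟘 ⊕ x ≋ x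
    ⊙-zeroˡ     : ∀ x → 0# ⊙ x ≋ 𝟘
    ⊙-identityˡ : ∀ x → 1# ⊙ x ≋ x
    ⊙-assoc     : ∀ a a′ x → (a * a′) ⊙ x ≋ a ⊙ (a′ ⊙ x)
    ⊙-distribʳ  : ∀ x a a′ → (a R.+ a′) ⊙ x ≋ a ⊙ x ⊕ a′ ⊙ x
    ⊙-distribˡ  : ∀ a x y → a ⊙ (x ⊕ y) ≋ a ⊙ x ⊕ a ⊙ y

  private
    infix 8 ⊝_
    ⊝_ : Combination → Combination
    ⊝ x = (- 1#) ⊙ x

    ⊕-identityʳ : ∀ x → x ⊕ 𝟘 ≋ x
    ⊕-identityʳ x = ≋-trans (⊕-comm x 𝟘) (⊕-identityˡ x)

    ⊙-zeroʳ : ∀ a → a ⊙ 𝟘 ≋ 𝟘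
    ⊙-zeroʳ a = ≋-trans (⊙-cong R.refl (≋-sym (⊙-zeroˡ 𝟘)))
               (≋-trans (≋-sym (⊙-assoc a 0# 𝟘))
               (≋-trans (⊙-cong (R.zeroʳ a) ≋-refl) (⊙-zeroˡ 𝟘)))

    ⊝-inverseˡ : ∀ x → ⊝ x ⊕ x ≋ 𝟘
    ⊝-inverseˡ x = ≋-trans (⊕-cong ≋-refl (≋-sym (⊙-identityˡ x)))
                  (≋-trans (≋-sym (⊙-distribʳ x (- 1#) 1#))
                  (≋-trans (⊙-cong (R.-‿inverseˡ 1#) ≋-refl) (⊙-zeroˡ x)))

    isModuleFromLeft : IsModuleFromLeft R _≋_ _⊕_ 𝟘 ⊝_ _⊙_
    isModuleFromLeft = record
      { isLeftModule = record
        { isLeftSemimodule = record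
          { +ᴹ-isCommutativeMonoid = record
            { isMonoid = record
              { isSemigroup = record
                { isMagma = record
                  { isEquivalence = record { refl = ≋-refl ; sym = ≋-sym ; trans = ≋-trans }
                  ; ∙-cong = ⊕-cong
                  }
                ; assoc = ⊕-assoc
                }
              ; identity = ⊕-identityˡ , ⊕-identityʳ
              }
            ; comm = ⊕-comm
            }
          ; isPreleftSemimodule = record
            { *ₗ-cong      = ⊙-cong
            ; *ₗ-zeroˡ     = ⊙-zeroˡ
            ; *ₗ-distribʳ  = ⊙-distribʳ
            ; *ₗ-identityˡ = ⊙-identityˡ
            ; *ₗ-assoc     = ⊙-assoc
            ; *ₗ-zeroʳ     = ⊙-zeroʳ
            ; *ₗ-distribˡ  = ⊙-distribˡ
            }
          }
        ; -ᴹ‿cong    = ⊙-cong R.refl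
        ; -ᴹ‿inverse = ⊝-inverseˡ , λ x → ≋-trans (⊕-comm x (⊝ x)) (⊝-inverseˡ x)
        }
      }

  freeModule : Module R (r ⊔ b) (r ⊔ ℓ ⊔ b)
  freeModule = record { isModule = IsModuleFromLeft.isModule isModuleFromLeft }

  module _ (M : Module R m ℓm) where
    open Module M

    extend : (B → Carrierᴹ) → Combination → Carrierᴹ
    extend f (basis w) = f w
    extend f 𝟘         = 0ᴹ
    extend f (x ⊕ y)   = extend f x +ᴹ extend f y
    extend f (a ⊙ x)   = a *ₗ extend f x

    extend-cong : ∀ f {x y} → x ≋ y → extend f x ≈ᴹ extend f y
    extend-cong f ≋-refl              = ≈ᴹ-refl
    extend-cong f (≋-sym e)           = ≈ᴹ-sym (extend-cong f e)
    extend-cong f (≋-trans e e′)      = ≈ᴹ-trans (extend-cong f e) (extend-cong f e′)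
    extend-cong f (⊕-cong e e′)       = +ᴹ-cong (extend-cong f e) (extend-cong f e′)
    extend-cong f (⊙-cong a e)        = *ₗ-cong a (extend-cong f e)
    extend-cong f (⊕-assoc x y z)     = +ᴹ-assoc _ _ _
    extend-cong f (⊕-comm x y)        = +ᴹ-comm _ _
    extend-cong f (⊕-identityˡ x)     = +ᴹ-identityˡ _
    extend-cong f (⊙-zeroˡ x)         = *ₗ-zeroˡ _
    extend-cong f (⊙-identityˡ x)     = *ₗ-identityˡ _
    extend-cong f (⊙-assoc a a′ x)    = *ₗ-assoc _ _ _
    extend-cong f (⊙-distribʳ x a a′) = *ₗ-distribʳ _ _ _
    extend-cong f (⊙-distribˡ a x y)  = *ₗ-distribˡ _ _ _

module _ (K : HeytingField c ℓ₁ ℓ₂) where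

  -- Fin n is 0-based, so that `comp p i f g` is f ∘_{i+1} g in the usual
  -- numbering of inputs. An equation suc k ≡ n + m stands for the arity
  -- k = n + m - 1; with the arity k free, the axioms need no transports.
  record Operad (m ℓm : Level) : Set (c ⊔ ℓ₁ ⊔ lsuc (m ⊔ ℓm)) where
    field
      space : ℕ → VectorSpace K m ℓm

    Element : ℕ → Set m
    Element n = Module.Carrierᴹ (space n)

    infix 4 _≈_
    _≈_ : ∀ {n} → Element n → Element n → Set ℓm
    _≈_ {n} = Module._≈ᴹ_ (space n)

    field
      unit : Element 1
      comp : ∀ {n m k} → suc k ≡ n + m → Fin n → Element n → Element m → Element k

      comp-linearˡ : ∀ {n m k} (p : suc k ≡ n + m) i (g : Element m) →
                     IsLinear (space n) (space k) (λ f → comp p i f g)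
      comp-linearʳ : ∀ {n m k} (p : suc k ≡ n + m) i (f : Element n) →
                     IsLinear (space m) (space k) (λ g → comp p i f g)

      unitˡ : ∀ {n} (p : suc n ≡ 1 + n) (f : Element n) → comp p zero unit f ≈ f
      unitʳ : ∀ {n} (p : suc n ≡ n + 1) i (f : Element n) → comp p i f unit ≈ f

      sequential : ∀ {n m l nm ml k}
                   (p : suc nm ≡ n + m) (q : suc k ≡ nm + l)
                   (p′ : suc ml ≡ m + l) (q′ : suc k ≡ n + ml)
                   (i : Fin n) (j : Fin m) (i+j : Fin nm) → toℕ i+j ≡ toℕ i + toℕ j →
                   (f : Element n) (g : Element m) (h : Element l) →
                   comp q i+j (comp p i f g) h ≈ comp q′ i f (comp p′ j g h)

      parallel : ∀ {n m l nm nl k}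
                 (p : suc nm ≡ n + m) (q : suc k ≡ nm + l)
                 (p′ : suc nl ≡ n + l) (q′ : suc k ≡ nl + m)
                 (i j : Fin n) → toℕ i < toℕ j →
                 (i′ : Fin nl) → toℕ i′ ≡ toℕ i →
                 (j′ : Fin nm) → suc (toℕ j′) ≡ toℕ j + m →
                 (f : Element n) (g : Element m) (h : Element l) →
                 comp q j′ (comp p i f g) h ≈ comp q′ i′ (comp p′ j f h) g

  record IsOperadIdeal (O : Operad m ℓm) (V : ∀ n → Pred (Operad.Element O n) p) :
                       Set (c ⊔ m ⊔ ℓm ⊔ p) where
    open Operad O
    field
      isSubspace  : ∀ n → IsSubspace (space n) (V n)
      comp-closed : ∀ {n m k} (q : suc k ≡ n + m) (i : Fin n) {f : Element n} {g : Element m} →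
                    f ∈ V n ⊎ g ∈ V m → comp q i f g ∈ V k

RangeMap : Set
RangeMap = (i : ℕ) → .{{NonZero i}} → ℕ

Unimodal : RangeMap → Set
Unimodal δ = ∀ i₁ i₂ i₃ .{{_ : NonZero i₁}} .{{_ : NonZero i₂}} .{{_ : NonZero i₃}} →
             i₁ < i₂ → i₂ < i₃ → ¬ (δ i₁ > δ i₂ × δ i₂ < δ i₃)

WeaklyIncreasing : RangeMap → Set
WeaklyIncreasing δ = ∀ i j .{{_ : NonZero i}} .{{_ : NonZero j}} → i ≤ j → δ i ≤ δ j

-- upTo i enumerates 0, …, i-1, and the maximum is taken in ℕ, where the
-- default value 0 is neutral.
bar : RangeMap → RangeMap
bar δ i = max 0 (map (λ j → δ (suc j)) (upTo i))

bar-weaklyIncreasing : ∀ δ → WeaklyIncreasing (bar δ)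
bar-weaklyIncreasing δ i j i≤j =
  max-mono-⊆ z≤n (map⁺ (λ k → δ (suc k)) (λ k∈ → ∈-upTo⁺ (<-≤-trans (∈-upTo⁻ k∈) i≤j)))

Word : Set
Word = List ℕ

-- The letter w(i+1) is `lookup w i`.
IsCliff : RangeMap → Word → Set
IsCliff δ w = (i : Fin (length w)) → lookup w i ≤ δ (suc (toℕ i))

size : Word → ℕ
size w = suc (length w)

-- A refinement type: cliffs are equal as soon as their words are.
Cliff : RangeMap → ℕ → Set
Cliff δ n = [ w ∈ Word ∣ IsCliff δ w × size w ≡ n ]

-- `u □⟨ i ⟩ v` is u □_{i+1} v.
infix 6 _□⟨_⟩_
_□⟨_⟩_ : Word → ℕ → Word → Word
u □⟨ i ⟩ v = take i u ++ v ++ drop i u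

private
  module _ (ρ : RangeMap) (inc : WeaklyIncreasing ρ) where

    BoundedFrom : ℕ → Word → Set
    BoundedFrom k w = (i : Fin (length w)) → lookup w i ≤ ρ (suc (k + toℕ i))

    tail-bounded : ∀ {k x} w → BoundedFrom k (x ∷ w) → BoundedFrom (suc k) w
    tail-bounded {k} w h i =
      ≤-trans (h (suc i)) (inc _ _ (≤-reflexive (cong suc (+-suc k (toℕ i)))))

    cons-bounded : ∀ {k x} w → x ≤ ρ (suc (k + 0)) → BoundedFrom (suc k) w → BoundedFrom k (x ∷ w)
    cons-bounded     w hx h zero    = hx
    cons-bounded {k} w hx h (suc i) =
      ≤-trans (h i) (inc _ _ (≤-reflexive (cong suc (sym (+-suc k (toℕ i))))))

    shift-bounded : ∀ {k} w → BoundedFrom k w → BoundedFrom (suc k) w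
    shift-bounded w h i = ≤-trans (h i) (inc _ _ (n≤1+n _))

    ++-bounded : ∀ {k} v u → BoundedFrom k v → BoundedFrom k u → BoundedFrom k (v ++ u)
    ++-bounded []      u hv hu = hu
    ++-bounded (x ∷ v) u hv hu =
      cons-bounded (v ++ u) (hv zero) (++-bounded v u (tail-bounded v hv) (shift-bounded u hu))

    □-bounded : ∀ {k} i u v → BoundedFrom k u → BoundedFrom k v → BoundedFrom k (u □⟨ i ⟩ v)
    □-bounded zero    u       v hu hv = ++-bounded v u hv hu
    □-bounded (suc i) []      v hu hv = ++-bounded v [] hv hu
    □-bounded (suc i) (x ∷ u) v hu hv =
      cons-bounded (u □⟨ i ⟩ v) (hu zero)
        (□-bounded i u v (tail-bounded u hu) (shift-bounded v hv))

  length-++-comm : ∀ (v u : Word) → length (v ++ u) ≡ length u + length v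
  length-++-comm []      u = sym (+-identityʳ (length u))
  length-++-comm (x ∷ v) u = trans (cong suc (length-++-comm v u)) (sym (+-suc (length u) (length v)))

  length-□ : ∀ i u v → length (u □⟨ i ⟩ v) ≡ length u + length v
  length-□ zero    u       v = length-++-comm v u
  length-□ (suc i) []      v = length-++-comm v []
  length-□ (suc i) (x ∷ u) v = cong suc (length-□ i u v)

  size-□ : ∀ {n m k} i u v → suc k ≡ n + m → size u ≡ n → size v ≡ m → size (u □⟨ i ⟩ v) ≡ k
  size-□ i u v e refl refl =
    trans (cong suc (length-□ i u v)) (trans (sym (+-suc _ _)) (sym (suc-injective e)))

  □-++ : ∀ j v u w → j ≤ length v → (v ++ u) □⟨ j ⟩ w ≡ (v □⟨ j ⟩ w) ++ u
  □-++ zero    v       u w _       = sym (++-assoc w v u)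
  □-++ (suc j) (x ∷ v) u w (s≤s h) = cong (x ∷_) (□-++ j v u w h)

  ++-□ : ∀ k v u w → (v ++ u) □⟨ length v + k ⟩ w ≡ v ++ (u □⟨ k ⟩ w)
  ++-□ k []      u w = refl
  ++-□ k (x ∷ v) u w = cong (x ∷_) (++-□ k v u w)

  □-sequential : ∀ i j u v w → i ≤ length u → j ≤ length v →
                 (u □⟨ i ⟩ v) □⟨ i + j ⟩ w ≡ u □⟨ i ⟩ (v □⟨ j ⟩ w)
  □-sequential zero    j u       v w _       hj = □-++ j v u w hj
  □-sequential (suc i) j (x ∷ u) v w (s≤s h) hj = cong (x ∷_) (□-sequential i j u v w h hj)

  □-parallel : ∀ i k u v w → i < k → k ≤ length u →
               (u □⟨ i ⟩ v) □⟨ length v + k ⟩ w ≡ (u □⟨ k ⟩ w) □⟨ i ⟩ v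
  □-parallel zero    k       u       v w _       _       = ++-□ k v u w
  □-parallel (suc i) (suc k) (x ∷ u) v w (s≤s l) (s≤s h) =
    trans (cong ((x ∷ u □⟨ i ⟩ v) □⟨_⟩ w) (+-suc (length v) k))
          (cong (x ∷_) (□-parallel i k u v w l h))

emptyCliff : ∀ δ → Cliff δ 1
emptyCliff δ = [] , [ (λ ()) , refl ]

insertCliff : ∀ {ρ} → WeaklyIncreasing ρ → ∀ {n m k} → suc k ≡ n + m → Fin n →
              Cliff ρ n → Cliff ρ m → Cliff ρ k
insertCliff {ρ} inc e i (u , [ hu ]) (v , [ hv ]) =
  u □⟨ toℕ i ⟩ v ,
  [ □-bounded ρ inc (toℕ i) u v (proj₁ hu) (proj₁ hv)
  , size-□ (toℕ i) u v e (proj₂ hu) (proj₂ hv) ]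

private
  size-value : ∀ δ {n} (w : Cliff δ n) → size (value w) ≡ n
  size-value δ {n} (w , [ h ]) = recompute (size w ≟ n) (proj₂ h)

  index-≤ : ∀ δ {n} (w : Cliff δ n) (i : Fin n) → toℕ i ≤ length (value w)
  index-≤ δ w i = s≤s⁻¹ (subst (suc (toℕ i) ≤_) (sym (size-value δ w)) (toℕ<n i))

private
  module _ {R : CommutativeRing r ℓ} where

    record Linear (M : Module R m ℓm) (N : Module R m′ ℓm′)
                  (f : Module.Carrierᴹ M → Module.Carrierᴹ N) : Set (r ⊔ m ⊔ ℓm ⊔ ℓm′) where
      private
        module R = CommutativeRing R
        module M = Module M
        module N = Module N
      field
        ⟦⟧-cong : ∀ {x y} → x M.≈ᴹ y → f x N.≈ᴹ f y
        +-homo  : ∀ x y → f (x M.+ᴹ y) N.≈ᴹ (f x N.+ᴹ f y)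
        *-homo  : ∀ a x → f (a M.*ₗ x) N.≈ᴹ (a N.*ₗ f x)

      0-homo : f M.0ᴹ N.≈ᴹ N.0ᴹ
      0-homo = N.≈ᴹ-trans (⟦⟧-cong (M.≈ᴹ-sym (M.*ₗ-zeroˡ M.0ᴹ)))
              (N.≈ᴹ-trans (*-homo R.0# M.0ᴹ) (N.*ₗ-zeroˡ _))

      neg-homo : ∀ x → f (M.-ᴹ x) N.≈ᴹ (N.-ᴹ f x)
      neg-homo x = ModuleProperties.inverseˡ-uniqueᴹ N _ _
        (N.≈ᴹ-trans (N.≈ᴹ-sym (+-homo _ _))
        (N.≈ᴹ-trans (⟦⟧-cong (proj₁ M.-ᴹ‿inverse x)) 0-homo))

      isLinear : IsLinear M N f
      isLinear = record
        { isBimoduleHomomorphism = record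
          { +ᴹ-isGroupHomomorphism = record
            { isMonoidHomomorphism = record
              { isMagmaHomomorphism = record
                { isRelHomomorphism = record { cong = ⟦⟧-cong }
                ; homo = +-homo
                }
              ; ε-homo = 0-homo
              }
            ; ⁻¹-homo = neg-homo
            }
          ; *ₗ-homo = *-homo
          ; *ᵣ-homo = λ a x →
              N.≈ᴹ-trans (⟦⟧-cong (M.≈ᴹ-sym (M.*ₗ-*ᵣ-coincident a x)))
             (N.≈ᴹ-trans (*-homo a x) (N.*ₗ-*ᵣ-coincident a (f x)))
          }
        }

    open Linear

    id-linear : (M : Module R m ℓm) → Linear M M (λ x → x)
    id-linear M = record
      { ⟦⟧-cong = λ e → e ; +-homo = λ _ _ → ≈ᴹ-refl ; *-homo = λ _ _ → ≈ᴹ-refl }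
      where open Module M

    ∘-linear : ∀ {n ℓn} {L : Module R n ℓn} {M : Module R m ℓm} {N : Module R m′ ℓm′} {f g} →
               Linear M N g → Linear L M f → Linear L N (λ x → g (f x))
    ∘-linear {N = N} G F = record
      { ⟦⟧-cong = λ e → ⟦⟧-cong G (⟦⟧-cong F e)
      ; +-homo  = λ x y → ≈ᴹ-trans (⟦⟧-cong G (+-homo F x y)) (+-homo G _ _)
      ; *-homo  = λ a x → ≈ᴹ-trans (⟦⟧-cong G (*-homo F a x)) (*-homo G a _)
      }
      where open Module N

    module _ {B : Set b} (N : Module R m ℓm) where
      open FreeModule R B
      open Module N
      private module R = CommutativeRing R

      extend-linear : ∀ f → Linear freeModule N (extend N f)
      extend-linear f = record
        { ⟦⟧-cong = extend-cong N f
        ; +-homo  = λ _ _ → ≈ᴹ-refl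
        ; *-homo  = λ _ _ → ≈ᴹ-refl
        }

      linear-unique : ∀ {f g} → Linear freeModule N f → Linear freeModule N g →
                      (∀ w → f (basis w) ≈ᴹ g (basis w)) → ∀ x → f x ≈ᴹ g x
      linear-unique F G h (basis w) = h w
      linear-unique F G h 𝟘         = ≈ᴹ-trans (0-homo F) (≈ᴹ-sym (0-homo G))
      linear-unique F G h (x ⊕ y)   = ≈ᴹ-trans (+-homo F x y) (≈ᴹ-trans
        (+ᴹ-cong (linear-unique F G h x) (linear-unique F G h y)) (≈ᴹ-sym (+-homo G x y)))
      linear-unique F G h (a ⊙ x)   = ≈ᴹ-trans (*-homo F a x) (≈ᴹ-trans
        (*ₗ-cong R.refl (linear-unique F G h x)) (≈ᴹ-sym (*-homo G a x)))

      extend-family : ∀ {l ℓl} (L : Module R l ℓl) {f : B → Module.Carrierᴹ L → Carrierᴹ} →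
                      (∀ w → Linear L N (f w)) → ∀ x → Linear L N (λ y → extend N (λ w → f w y) x)
      extend-family L F (basis w) = F w
      extend-family L F 𝟘         = record
        { ⟦⟧-cong = λ _ → ≈ᴹ-refl
        ; +-homo  = λ _ _ → ≈ᴹ-sym (+ᴹ-identityˡ 0ᴹ)
        ; *-homo  = λ a _ → ≈ᴹ-sym (*ₗ-zeroʳ a)
        }
      extend-family L F (x ⊕ y) = record
        { ⟦⟧-cong = λ e → +ᴹ-cong (⟦⟧-cong X e) (⟦⟧-cong Y e)
        ; +-homo  = λ s t → ≈ᴹ-trans (+ᴹ-cong (+-homo X s t) (+-homo Y s t)) (interchange _ _ _ _)
        ; *-homo  = λ a s → ≈ᴹ-trans (+ᴹ-cong (*-homo X a s) (*-homo Y a s)) (≈ᴹ-sym (*ₗ-distribˡ a _ _))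
        }
        where
        X = extend-family L F x
        Y = extend-family L F y
        open CommutativeSemigroupProperties
          (CommutativeMonoid.commutativeSemigroup +ᴹ-commutativeMonoid) using (interchange)
      extend-family L F (a ⊙ x) = record
        { ⟦⟧-cong = λ e → *ₗ-cong R.refl (⟦⟧-cong X e)
        ; +-homo  = λ s t → ≈ᴹ-trans (*ₗ-cong R.refl (+-homo X s t)) (*ₗ-distribˡ a _ _)
        ; *-homo  = λ a′ s → ≈ᴹ-trans (*ₗ-cong R.refl (*-homo X a′ s)) (*ₗ-comm a a′ _)
        }
        where X = extend-family L F x

module _ (K : HeytingField c ℓ₁ ℓ₂) where

  open FreeModule {b = 0ℓ} (scalars K)

  Cl : (ρ : RangeMap) → WeaklyIncreasing ρ → Operad K c (c ⊔ ℓ₁)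
  Cl ρ inc = record
    { space        = space
    ; unit         = basis (emptyCliff ρ)
    ; comp         = comp
    ; comp-linearˡ = λ p i g → Linear.isLinear (linearˡ p i g)
    ; comp-linearʳ = λ p i f → Linear.isLinear (linearʳ p i f)
    ; unitˡ        = λ {n} p → linear-unique (space n) (linearʳ p zero (basis (emptyCliff ρ))) (id-linear (space n))
                       λ w → ≋-reflexive (++-identityʳ (value w))
    ; unitʳ        = λ {n} p i → linear-unique (space n) (linearˡ p i (basis (emptyCliff ρ))) (id-linear (space n))
                       λ w → ≋-reflexive (take++drop≡id (toℕ i) (value w))
    ; sequential   = λ {k = k} p q p′ q′ i j i+j e f g h →
        linear-unique (space k)
          (∘-linear (linearˡ q i+j h) (linearˡ p i g))
          (linearˡ q′ i (comp p′ j g h))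
          (λ u → linear-unique (space k)
            (∘-linear (linearˡ q i+j h) (linearʳ p i (basis u)))
            (∘-linear (linearʳ q′ i (basis u)) (linearˡ p′ j h))
            (λ v → linear-unique (space k)
              (linearʳ q i+j (comp p i (basis u) (basis v)))
              (∘-linear (linearʳ q′ i (basis u)) (linearʳ p′ j (basis v)))
              (λ w → ≋-reflexive (trans
                (cong (λ t → (value u □⟨ toℕ i ⟩ value v) □⟨ t ⟩ value w) e)
                (□-sequential (toℕ i) (toℕ j) (value u) (value v) (value w)
                  (index-≤ ρ u i) (index-≤ ρ v j))))
              h) g) f
    ; parallel     = λ {k = k} p q p′ q′ i j i<j i′ e j′ e′ f g h →
        linear-unique (space k)
          (∘-linear (linearˡ q j′ h) (linearˡ p i g))
          (∘-linear (linearˡ q′ i′ g) (linearˡ p′ j h))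
          (λ u → linear-unique (space k)
            (∘-linear (linearˡ q j′ h) (linearʳ p i (basis u)))
            (linearʳ q′ i′ (comp p′ j (basis u) h))
            (λ v → linear-unique (space k)
              (linearʳ q j′ (comp p i (basis u) (basis v)))
              (∘-linear (linearˡ q′ i′ (basis v)) (linearʳ p′ j (basis u)))
              (λ w → ≋-reflexive (trans
                (cong (λ t → (value u □⟨ toℕ i ⟩ value v) □⟨ t ⟩ value w) (shifted v j j′ e′))
                (trans
                  (□-parallel (toℕ i) (toℕ j) (value u) (value v) (value w) i<j (index-≤ ρ u j))
                  (cong (λ t → (value u □⟨ toℕ j ⟩ value w) □⟨ t ⟩ value v) (sym e)))))
              h) g) f
    }
    where
    space : ℕ → VectorSpace K c (c ⊔ ℓ₁)
    space n = freeModule (Cliff ρ n)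

    comp : ∀ {n m k} → suc k ≡ n + m → Fin n →
           Combination (Cliff ρ n) → Combination (Cliff ρ m) → Combination (Cliff ρ k)
    comp {n} {m} {k} p i f g =
      extend (Cliff ρ n) (space k) (λ u →
        extend (Cliff ρ m) (space k) (λ v → basis (insertCliff inc p i u v)) g) f

    linearˡ : ∀ {n m k} (p : suc k ≡ n + m) i g → Linear (space n) (space k) (λ f → comp p i f g)
    linearˡ {k = k} p i g = extend-linear (space k) _

    linearʳ : ∀ {n m k} (p : suc k ≡ n + m) i f → Linear (space m) (space k) (λ g → comp p i f g)
    linearʳ {m = m} {k} p i f = extend-family (space k) (space m) (λ u → extend-linear (space k) _) f

    ≋-reflexive : ∀ {n} {v w : Cliff ρ n} → value v ≡ value w → _≋_ (Cliff ρ n) (basis v) (basis w)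
    ≋-reflexive {n} {v} {w} e =
      subst (λ t → _≋_ (Cliff ρ n) (basis v) (basis t)) (value-injective {v = v} {w = w} e) ≋-refl

    shifted : ∀ {n m nm} (v : Cliff ρ m) (j : Fin n) (j′ : Fin nm) → suc (toℕ j′) ≡ toℕ j + m →
              toℕ j′ ≡ length (value v) + toℕ j
    shifted v j j′ e = suc-injective (trans e
      (trans (+-comm (toℕ j) _) (cong (_+ toℕ j) (sym (size-value ρ v)))))

  V : (δ : RangeMap) → ∀ n → Pred (Operad.Element (Cl (bar δ) (bar-weaklyIncreasing δ)) n) (c ⊔ ℓ₁)
  V δ n = Span (freeModule (Cliff (bar δ) n))
               (λ x → Σ[ w ∈ Cliff (bar δ) n ] ¬ IsCliff δ (value w) × x ≡ basis w)

{-# OPTIONS --safe #-}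

-- Inserting a word moves each letter weakly to the right. If a letter x ≤ bar δ j
-- exceeds δ j, then an earlier value of δ exceeds δ j, so a unimodal δ cannot rise
-- above δ j after j, and the letter stays out of range: cliffs of bar δ that are
-- not δ-cliffs are stable under composition. Conversely, a valley
-- δ i₁ > δ i₂ < δ i₃ allows the letter δ i₂ + 1 at position i₂ for bar δ only, and
-- inserting i₃ - i₂ zeros in front of the word moves this letter to position i₃,
-- where δ allows it. The linear functional sending E_w to 1 or 0 according to
-- whether w is a δ-cliff shows that the resulting basis vector is not in V_δ.
module Submission where

open import Defs
open import Algebra.Apartness.Bundles using (HeytingField)
import Algebra.Apartness.Properties.HeytingCommutativeRing as HeytingProperties
open import Algebra.Bundles using (CommutativeRing)
open import Algebra.Module.Construct.TensorUnit using (⟨module⟩)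
open import Data.Bool.Base using (if_then_else_)
open import Data.Fin.Base using (Fin; zero; suc; toℕ)
open import Data.Fin.Properties using (all?)
open import Data.Irrelevant using ([_])
open import Data.List.Base using ([]; _∷_; _++_; length; lookup; take; drop; replicate)
open import Data.List.Extrema.Nat using (max≤v⁺; v≤max⁺)
open import Data.List.Properties using (take++drop≡id)
open import Data.List.Relation.Binary.Sublist.Propositional using (_⊆_; _∷_; _∷ʳ_; ⊆-refl)
open import Data.List.Relation.Binary.Sublist.Propositional.Properties using (++⁺; ++⁺ˡ; ++⁺ʳ)
import Data.List.Relation.Unary.All.Properties as All
import Data.List.Relation.Unary.Any.Properties as Any
open import Data.Nat.Base using (ℕ; zero; suc; _+_; _∸_; _≤_; _<_; NonZero; z≤n; s≤s; s≤s⁻¹)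
open import Data.Nat.Properties
  using (_≤?_; ≤-refl; ≤-trans; <⇒≤; <⇒≱; ≮⇒≥; ≰⇒>; m≤n⇒m≤1+n; m≤n⇒m<n∨m≡n; m∸n+n≡m)
open import Data.Product.Base using (∃-syntax; _×_; _,_; proj₁)
open import Data.Refinement using (_,_; value)
open import Data.Sum.Base using (_⊎_; inj₁; inj₂)
open import Function.Base using (id)
open import Function.Bundles using (_⇔_; mk⇔)
open import Level using (0ℓ)
open import Relation.Binary.PropositionalEquality using (_≡_; refl; sym; cong; subst)
open import Relation.Nullary using (¬_; Dec; yes; no; does; recompute)
open import Relation.Nullary.Decidable using (dec-true; dec-false)
open import Relation.Unary using (_∈_)

isCliff? : ∀ δ w → Dec (IsCliff δ w)
isCliff? δ w = all? (λ i → lookup w i ≤? δ (suc (toℕ i)))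

≤-bar : ∀ δ i j .{{_ : NonZero i}} .{{_ : NonZero j}} → i ≤ j → δ i ≤ bar δ j
≤-bar δ (suc i) j i<j = v≤max⁺ 0 _ (inj₂ (Any.map⁺ (Any.applyUpTo⁺ id ≤-refl i<j)))

bar-≤ : ∀ δ j .{{_ : NonZero j}} {x} → (∀ i → i < j → δ (suc i) ≤ x) → bar δ j ≤ x
bar-≤ δ j h = max≤v⁺ z≤n (All.map⁺ (All.applyUpTo⁺₁ id j (h _)))

-- If `δ` is larger at `suc j` than at `suc i`, unimodality forbids a larger value before `suc i`,
-- so the running maximum there is `δ (suc i)` itself.
unimodal-≤ : ∀ {δ} → Unimodal δ → ∀ {i j x} → i ≤ j →
             x ≤ bar δ (suc i) → x ≤ δ (suc j) → x ≤ δ (suc i)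
unimodal-≤ {δ} U {i} {j} i≤j x≤bar x≤δj with m≤n⇒m<n∨m≡n i≤j | δ (suc j) ≤? δ (suc i)
... | inj₂ refl | _         = x≤δj
... | inj₁ _    | yes δj≤δi = ≤-trans x≤δj δj≤δi
... | inj₁ i<j  | no  δj≰δi = ≤-trans x≤bar (bar-≤ δ (suc i) earlier)
  where
  earlier : ∀ k → k < suc i → δ (suc k) ≤ δ (suc i)
  earlier k (s≤s k≤i) with m≤n⇒m<n∨m≡n k≤i
  ... | inj₂ refl = ≤-refl
  ... | inj₁ k<i  = ≮⇒≥ λ δk>δi → U (suc k) (suc i) (suc j) (s≤s k<i) (s≤s i<j) (δk>δi , ≰⇒> δj≰δi)

-- Sublists forget where an insertion took place: both factors of a composite embed in it, so one
-- argument serves both sides.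
⊆-lookup : ∀ {w w′ : Word} → w ⊆ w′ → (i : Fin (length w)) →
           ∃[ j ] toℕ i ≤ toℕ j × lookup w′ j ≡ lookup w i
⊆-lookup (y ∷ʳ τ) i with ⊆-lookup τ i
... | j , i≤j , e = suc j , m≤n⇒m≤1+n i≤j , e
⊆-lookup (refl ∷ τ) zero = zero , z≤n , refl
⊆-lookup (refl ∷ τ) (suc i) with ⊆-lookup τ i
... | j , i≤j , e = suc j , s≤s i≤j , e

⊆-□ˡ : ∀ i u v → u ⊆ u □⟨ i ⟩ v
⊆-□ˡ i u v = subst (_⊆ u □⟨ i ⟩ v) (take++drop≡id i u) (++⁺ (⊆-refl {x = take i u}) (++⁺ˡ v ⊆-refl))

⊆-□ʳ : ∀ i u v → v ⊆ u □⟨ i ⟩ v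
⊆-□ʳ i u v = ++⁺ˡ (take i u) (++⁺ʳ (drop i u) ⊆-refl)

isCliff-⊆ : ∀ {δ} → Unimodal δ → ∀ {n} (w : Cliff (bar δ) n) {w′} →
            value w ⊆ w′ → IsCliff δ w′ → IsCliff δ (value w)
isCliff-⊆ {δ} U (w , [ h ]) τ c i with ⊆-lookup τ i
... | j , i≤j , e = unimodal-≤ U i≤j
  -- The bound stored in a cliff is irrelevant; decidability of `≤` recovers it.
  (recompute (_ ≤? _) (proj₁ h i))
  (subst (_≤ δ (suc (toℕ j))) e (c j))

-- Zeros fit under every range map, so only the last letter, at position `k + 1`, is constrained.
spike : ℕ → ℕ → Word
spike k x = replicate k 0 ++ x ∷ []

spike-isCliff : ∀ ρ k x → x ≤ ρ (suc k) → IsCliff ρ (spike k x)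
spike-isCliff ρ zero    x h zero    = h
spike-isCliff ρ (suc k) x h zero    = z≤n
-- Removing the leading zero shifts the range map, so `ρ` varies in the induction.
spike-isCliff ρ (suc k) x h (suc i) = spike-isCliff (λ j → ρ (suc j)) k x h i

spike-isCliff⁻¹ : ∀ ρ k x → IsCliff ρ (spike k x) → x ≤ ρ (suc k)
spike-isCliff⁻¹ ρ zero    x c = c zero
spike-isCliff⁻¹ ρ (suc k) x c = spike-isCliff⁻¹ (λ j → ρ (suc j)) k x (λ i → c (suc i))

zeros-isCliff : ∀ ρ k → IsCliff ρ (replicate k 0)
zeros-isCliff ρ (suc k) zero    = z≤n
zeros-isCliff ρ (suc k) (suc i) = zeros-isCliff (λ j → ρ (suc j)) k i

zeros-++-spike : ∀ d k x → replicate d 0 ++ spike k x ≡ spike (d + k) x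
zeros-++-spike zero    k x = refl
zeros-++-spike (suc d) k x = cong (0 ∷_) (zeros-++-spike d k x)

module _ {c ℓ₁ ℓ₂} (K : HeytingField c ℓ₁ ℓ₂) (δ : RangeMap) where

  private
    R = scalars K
    module R = CommutativeRing R
    inc = bar-weaklyIncreasing δ
    O = Cl K (bar δ) inc

  open FreeModule {b = 0ℓ} R using (Combination; basis; 𝟘; _⊕_; _⊙_; freeModule; extend; extend-cong)
  open Operad O using (space; comp)

  1≉0 : ¬ (R.1# R.≈ R.0#)
  1≉0 1≈0 = HeytingField.#-irrefl K 1≈0
    (HeytingProperties.1#0 (HeytingField.heytingCommutativeRing K))

  indicator : ∀ {n} → Cliff (bar δ) n → R.Carrier
  indicator w = if does (isCliff? δ (value w)) then R.1# else R.0#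

  -- The functional is linear and kills the generators, so induction on the span derivation
  -- suffices.
  V-vanishing : ∀ {n x} → x ∈ V K δ n → extend (Cliff (bar δ) n) ⟨module⟩ indicator x R.≈ R.0#
  V-vanishing (incl (w , ¬c , refl)) rewrite dec-false (isCliff? δ (value w)) ¬c = R.refl
  V-vanishing (resp e v) =
    R.trans (R.sym (extend-cong (Cliff (bar δ) _) ⟨module⟩ indicator e)) (V-vanishing v)
  V-vanishing zero        = R.refl
  V-vanishing (plus v v′) = R.trans (R.+-cong (V-vanishing v) (V-vanishing v′)) (R.+-identityˡ _)
  V-vanishing (scale a v) = R.trans (R.*-congˡ (V-vanishing v)) (R.zeroʳ a)

  basis∈V⇒¬isCliff : ∀ {n} {w : Cliff (bar δ) n} → basis w ∈ V K δ n → ¬ IsCliff δ (value w)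
  basis∈V⇒¬isCliff {w = w} v c with V-vanishing v
  ... | e rewrite dec-true (isCliff? δ (value w)) c = 1≉0 e

  ideal⇒unimodal : IsOperadIdeal K O (V K δ) → Unimodal δ
  ideal⇒unimodal I i₁ (suc b) (suc d) i₁<i₂ i₂<i₃ (δ₁>δ₂ , δ₂<δ₃) =
    basis∈V⇒¬isCliff
      -- Index `zero` inserts before the first letter, so the composite word reduces to `v` followed
      -- by `u`.
      (IsOperadIdeal.comp-closed I refl zero {basis u} {basis v}
        (inj₁ (incl (u , u∉Clδ , refl))))
      uv∈Clδ
    where
    x : ℕ
    -- The least letter too large at `suc b`; the two inequalities of the valley are literally
    -- `x ≤ δ i₁` and `x ≤ δ (suc d)`.
    x = suc (δ (suc b))

    u : Cliff (bar δ) (size (spike b x))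
    u = spike b x ,
      [ spike-isCliff (bar δ) b x (≤-trans δ₁>δ₂ (≤-bar δ i₁ (suc b) (<⇒≤ i₁<i₂))) , refl ]

    v : Cliff (bar δ) (size (replicate (d ∸ b) 0))
    v = replicate (d ∸ b) 0 , [ zeros-isCliff (bar δ) (d ∸ b) , refl ]

    u∉Clδ : ¬ IsCliff δ (spike b x)
    u∉Clδ c = <⇒≱ ≤-refl (spike-isCliff⁻¹ δ b x c)

    uv∈Clδ : IsCliff δ (replicate (d ∸ b) 0 ++ spike b x)
    uv∈Clδ = subst (IsCliff δ) (sym (zeros-++-spike (d ∸ b) b x))
      -- As `b ≤ d`, the truncated subtraction is exact and `x` lands at position `suc d`.
      (subst (λ k → IsCliff δ (spike k x)) (sym (m∸n+n≡m (s≤s⁻¹ (<⇒≤ i₂<i₃))))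
        (spike-isCliff δ d x δ₂<δ₃))

  -- For the factor of a composition that is arbitrary; `extend-∈V⁺` treats the factor lying in `V`,
  -- where only generators need checking.
  extend-∈V : ∀ {n k} {f : Cliff (bar δ) n → Combination (Cliff (bar δ) k)} →
              (∀ w → f w ∈ V K δ k) → ∀ x → extend (Cliff (bar δ) n) (space k) f x ∈ V K δ k
  extend-∈V h (basis w) = h w
  extend-∈V h 𝟘         = zero
  extend-∈V h (x ⊕ y)   = plus (extend-∈V h x) (extend-∈V h y)
  extend-∈V h (a ⊙ x)   = scale a (extend-∈V h x)

  extend-∈V⁺ : ∀ {n k} {f : Cliff (bar δ) n → Combination (Cliff (bar δ) k)} →
               (∀ w → ¬ IsCliff δ (value w) → f w ∈ V K δ k) →
               ∀ {x} → x ∈ V K δ n → extend (Cliff (bar δ) n) (space k) f x ∈ V K δ k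
  extend-∈V⁺ h (incl (w , ¬c , refl)) = h w ¬c
  extend-∈V⁺ h (resp e v)  = resp (extend-cong (Cliff (bar δ) _) (space _) _ e) (extend-∈V⁺ h v)
  extend-∈V⁺ h zero        = zero
  extend-∈V⁺ h (plus v v′) = plus (extend-∈V⁺ h v) (extend-∈V⁺ h v′)
  extend-∈V⁺ h (scale a v) = scale a (extend-∈V⁺ h v)

  unimodal⇒ideal : Unimodal δ → IsOperadIdeal K O (V K δ)
  unimodal⇒ideal U = record
    { isSubspace  = λ n → record
      { resp = resp ; 0ᴹ-closed = zero ; +ᴹ-closed = plus ; *ₗ-closed = scale }
    ; comp-closed = closed
    }
    where
    closed : ∀ {n m k} (q : suc k ≡ n + m) (i : Fin n) {f g} →
             f ∈ V K δ n ⊎ g ∈ V K δ m → comp q i f g ∈ V K δ k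
    -- `comp` extends over `f` outside and `g` inside, which fixes how the two extension lemmas
    -- nest.
    closed q i {g = g} (inj₁ f∈V) = extend-∈V⁺ (λ u ¬c → extend-∈V (λ v →
      incl (insertCliff inc q i u v
           , (λ c → ¬c (isCliff-⊆ U u (⊆-□ˡ (toℕ i) (value u) (value v)) c)) , refl)) g) f∈V
    closed q i {f = f} (inj₂ g∈V) = extend-∈V (λ u → extend-∈V⁺ (λ v ¬c →
      incl (insertCliff inc q i u v
           , (λ c → ¬c (isCliff-⊆ U v (⊆-□ʳ (toℕ i) (value u) (value v)) c)) , refl)) g∈V) f

proposition2p1p1 : ∀ {c ℓ₁ ℓ₂} (K : HeytingField c ℓ₁ ℓ₂) → CharacteristicZero K →
    (δ : RangeMap) →
    IsOperadIdeal K (Cl K (bar δ) (bar-weaklyIncreasing δ)) (V K δ) ⇔ Unimodal δ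
proposition2p1p1 K _ δ = mk⇔ (ideal⇒unimodal K δ) (unimodal⇒ideal K δ)
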